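{- Any finite-valued nondeterministic finite transducer (NFT) that has an equivalent two-tape deterministic finite automaton (2DFA) has bounded trailing.
   Context: A two-tape deterministic finite automaton (2DFA) is a tuple $A=(Q,\Sigma,\Gamma,\sqcup,\delta,q_0,F)$ with finite nonempty state set $Q$, input alphabet $\Sigma$, output alphabet $\Gamma$, a blank (end-delimiter) symbol $\sqcup\notin\Sigma\cup\Gamma$, initial state $q_0$, accepting states $F$, and transition function $\delta\colon Q\times(\Sigma\cup\{\sqcup\})\times(\Gamma\cup\{\sqcup\})\to Q\times\{\mathrm{Stay},\mathrm{Advance}\}^2$ such that a head reading $\sqcup$ stays and at least one head advances per step. It reads $a\in\Sigma^*$ on the input tape and $u\in\Gamma^*$ on the output tape with one-way heads; $(a,u)\in L(A)$ iff it ends in an accepting state once both heads reach the blanks. A nondeterministic finite transducer (NFT) is $T=(Q,\Sigma,\Gamma,\delta,q_0,F)$ with $\delta$ mapping each $(q,\sigma)\in Q\times\Sigma$ to a finite subset of $Q\times\Gamma^*$; $q\xrightarrow{a/u}q'$ means $T$ can go from $q$ to $q'$ reading $a$ and producing $u$, and $L(T)=\{(a,u)\mid q_0\xrightarrow{a/u}f,\ f\in F\}$. $T$ is finite-valued if there is $k$ such that every input $a$ is related by $L(T)$ to at most $k$ outputs. $T$ is equivalent to $A$ if $L(T)=L(A)$. $T$ has bounded trailing if there is $t\in\mathbb{N}$ such that for all $q_1,q_2\in Q$, $f_1,f_2\in F$, $a,b_1,b_2\in\Sigma^*$, $u,v,w_1,w_2\in\Gamma^*$: if $q_0\xrightarrow{a/uv}q_1\xrightarrow{b_1/w_1}f_1$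 and $q_0\xrightarrow{a/u}q_2\xrightarrow{b_2/vw_2}f_2$, then $|v|\le t$. -}

module Defs where

open import Data.Nat using (ℕ; _≤_)
open import Data.Fin using (Fin)
open import Data.Bool using (Bool; true)
open import Data.Maybe using (Maybe; just; nothing)
open import Data.List using (List; []; _∷_; _++_; length)
open import Data.List.Membership.Propositional using (_∈_)
open import Data.List.Relation.Unary.All using (All)
open import Data.List.Relation.Unary.Unique.Propositional using (Unique)
open import Data.Product using (_×_; _,_; Σ; ∃; ∃-syntax)
open import Data.Sum using (_⊎_)
open import Relation.Binary.PropositionalEquality using (_≡_)
open import Relation.Nullary using (¬_)
open import Function.Bundles using (_⇔_)

-- Alphabets are finite: Σ = Fin s, Γ = Fin g. States: Fin n.
-- The blank symbol ⊔ is represented by 'nothing' (symbols from Σ ∪ {⊔} are Maybe (Fin s)).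

data Move : Set where
  Stay Advance : Move

-- symbol under a one-way head reading the remaining word (blank when exhausted)
head? : {A : Set} → List A → Maybe A
head? []      = nothing
head? (x ∷ _) = just x

move : {A : Set} → Move → List A → List A
move Stay    w       = w
move Advance []      = []
move Advance (_ ∷ w) = w

record 2DFA (s g : ℕ) : Set where
  field
    nQ     : ℕ
    δ      : Fin nQ → Maybe (Fin s) → Maybe (Fin g) → Fin nQ × Move × Move
    q₀     : Fin nQ
    F      : Fin nQ → Bool
    blank-stay₁ : ∀ q y {q' m₁ m₂} → δ q nothing y ≡ (q' , m₁ , m₂) → m₁ ≡ Stay
    blank-stay₂ : ∀ q x {q' m₁ m₂} → δ q x nothing ≡ (q' , m₁ , m₂) → m₂ ≡ Stay
    -- at least one head advances per step (a step is only taken while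
    -- not both heads read the blank)
    progress : ∀ q x y {q' m₁ m₂} → ¬ (x ≡ nothing × y ≡ nothing) →
               δ q x y ≡ (q' , m₁ , m₂) → m₁ ≡ Advance ⊎ m₂ ≡ Advance

module _ {s g : ℕ} (A : 2DFA s g) where
  open 2DFA A

  data Run : Fin nQ → List (Fin s) → List (Fin g) → Fin nQ → Set where
    done : ∀ {q} → Run q [] [] q
    step : ∀ {q a u q' m₁ m₂ q''} →
           ¬ (a ≡ [] × u ≡ []) →
           δ q (head? a) (head? u) ≡ (q' , m₁ , m₂) →
           Run q' (move m₁ a) (move m₂ u) q'' →
           Run q a u q''

  L2DFA : List (Fin s) → List (Fin g) → Set
  L2DFA a u = Σ (Fin nQ) λ f → Run q₀ a u f × F f ≡ true

record NFT (s g : ℕ) : Set where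
  field
    nQ : ℕ
    δ  : Fin nQ → Fin s → List (Fin nQ × List (Fin g))   -- finite subset
    q₀ : Fin nQ
    F  : Fin nQ → Bool

module _ {s g : ℕ} (T : NFT s g) where
  open NFT T

  data Path : Fin nQ → List (Fin s) → List (Fin g) → Fin nQ → Set where
    nil  : ∀ {q} → Path q [] [] q
    cons : ∀ {q σ q₁ w a u q'} →
           (q₁ , w) ∈ δ q σ →
           Path q₁ a u q' →
           Path q (σ ∷ a) (w ++ u) q'

  LNFT : List (Fin s) → List (Fin g) → Set
  LNFT a u = Σ (Fin nQ) λ f → Path q₀ a u f × F f ≡ true

  FiniteValued : Set
  FiniteValued = ∃[ k ] ∀ (a : List (Fin s)) (us : List (List (Fin g))) →
                 Unique us → All (LNFT a) us → length us ≤ k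

  BoundedTrailing : Set
  BoundedTrailing = ∃[ t ] ∀ (q₁ q₂ f₁ f₂ : Fin nQ)
    (a b₁ b₂ : List (Fin s)) (u v w₁ w₂ : List (Fin g)) →
    Path q₀ a (u ++ v) q₁ → Path q₁ b₁ w₁ f₁ → F f₁ ≡ true →
    Path q₀ a u q₂ → Path q₂ b₂ (v ++ w₂) f₂ → F f₂ ≡ true →
    length v ≤ t

Equivalent : {s g : ℕ} → NFT s g → 2DFA s g → Set
Equivalent T A = ∀ a u → LNFT T a u ⇔ L2DFA A a u

-- Cut path 2 after each prefix m of v and complete it briefly: T accepts pairs
-- (a b , u m w) with w bounded.  Path 1 has already emitted u v on a, so A,
-- being deterministic, either has consumed u m by the end of a for every such
-- pair, or reaches the end of a on path 1 with much output left although only a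
-- bounded input remains.  In both cases, if v is long, many cuts m leave A in the
-- same situation.  Exchanging what A has consumed before the cut then relates one
-- input to outputs of many different lengths, against finite-valuedness.

module Submission where

open import Defs
open import Data.Nat using (ℕ; zero; suc; _+_; _*_; _⊔_; _≤_; _<_; z≤n; s≤s; _≟_; _≤?_)
open import Data.Nat.Properties
open import Data.Fin using (Fin; zero; suc; toℕ; fromℕ<; combine)
open import Data.Fin.Properties as Fin using (toℕ<n; toℕ-injective; combine-injective)
open import Data.Bool using (true)
open import Data.Empty using (⊥-elim)
open import Data.Maybe using (Maybe; just; nothing)
open import Data.List using (List; []; _∷_; _++_; length; map; filter; take; drop; allFin)
open import Data.List.Properties using (++-assoc; ++-cancelʳ; length-++; length-take; length-drop; length-map; length-tabulate; take++drop≡id; ∷-injective)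
open import Data.List.Membership.Propositional using (_∈_)
import Data.List.Membership.DecPropositional as DecMembership
open import Data.List.Relation.Unary.All as All using (All; []; _∷_)
open import Data.List.Relation.Unary.All.Properties as All using (all-filter; ¬Any⇒All¬)
open import Data.List.Relation.Unary.Any using (here; there)
open import Data.List.Relation.Unary.AllPairs using ([]; _∷_)
open import Data.List.Relation.Unary.Unique.Propositional using (Unique)
import Data.List.Relation.Unary.Unique.Propositional.Properties as Unique
open import Data.Product using (_×_; _,_; Σ; ∃; ∃₂; ∃-syntax; proj₁; proj₂)
open import Data.Sum using (_⊎_; inj₁; inj₂)
open import Function using (_∘_; id)
open import Function.Bundles using (module Equivalence)
open import Relation.Nullary using (¬_; yes; no; ¬?)
open import Level using (0ℓ)
open import Relation.Unary using (Pred; Decidable)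
open import Relation.Binary.PropositionalEquality

-- Prefixes and lengths of words

private variable
  X Y : Set

head?-++ : ∀ (xs : List X) {ys zs} → head? ys ≡ head? zs → head? (xs ++ ys) ≡ head? (xs ++ zs)
head?-++ []      eq = eq
head?-++ (_ ∷ _) _  = refl

-- Levi's lemma for words; factors of equal length fall under the first case.
++-compare : ∀ (ws : List X) {us} ms {vs} → ws ++ us ≡ ms ++ vs →
  (∃[ r ] ws ≡ ms ++ r × r ++ us ≡ vs) ⊎ (∃[ r ] ms ≡ ws ++ r × us ≡ r ++ vs)
++-compare ws       []       eq = inj₁ (ws , refl , eq)
++-compare []       (m ∷ ms) eq = inj₂ (m ∷ ms , refl , eq)
++-compare (w ∷ ws) (m ∷ ms) eq with ∷-injective eq
... | refl , eq′ with ++-compare ws ms eq′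
...   | inj₁ (r , p , q) = inj₁ (r , cong (w ∷_) p , q)
...   | inj₂ (r , p , q) = inj₂ (r , cong (w ∷_) p , q)

prefix-unique : ∀ (xs ys : List X) {xs′ ys′} → xs ++ xs′ ≡ ys ++ ys′ → length xs ≡ length ys → xs ≡ ys
prefix-unique []       []       _  _  = refl
prefix-unique (x ∷ xs) (y ∷ ys) eq l with ∷-injective eq
... | p , eq′ = cong₂ _∷_ p (prefix-unique xs ys eq′ (suc-injective l))

length-take-≤ : ∀ {n} {xs : List X} → n ≤ length xs → length (take n xs) ≡ n
length-take-≤ {n = n} {xs} n≤ = trans (length-take n xs) (m≤n⇒m⊓n≡m n≤)

length-++-cancelˡ : ∀ (xs : List X) {ys zs} → length (xs ++ ys) ≡ length (xs ++ zs) → length ys ≡ length zs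
length-++-cancelˡ []       eq = eq
length-++-cancelˡ (_ ∷ xs) eq = length-++-cancelˡ xs (suc-injective eq)

-- Counting by fibres, finite maxima and coding of symbols

length-filter-¬ : ∀ {P : Pred X 0ℓ} (P? : Decidable P) xs →
  length (filter P? xs) + length (filter (¬? ∘ P?) xs) ≡ length xs
length-filter-¬ P? [] = refl
length-filter-¬ P? (x ∷ xs) with P? x
... | yes _ = cong suc (length-filter-¬ P? xs)
... | no  _ = trans (+-suc _ _) (cong suc (length-filter-¬ P? xs))

-- Induction on the number of values: the fibre over the largest one is split off by filtering, and
-- the remaining elements take smaller values.
pigeonhole-fibres : ∀ N k (f : X → ℕ) →
  (∀ n xs → Unique xs → All (λ x → f x ≡ n) xs → length xs ≤ k) →
  ∀ xs → Unique xs → All (λ x → f x < N) xs → length xs ≤ N * k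
pigeonhole-fibres zero    k f small []       _  _        = z≤n
pigeonhole-fibres zero    k f small (_ ∷ _)  _  (() ∷ _)
pigeonhole-fibres {X} (suc N) k f small xs u! f< = begin
  length xs                                             ≡⟨ sym (length-filter-¬ N? xs) ⟩
  length (filter N? xs) + length (filter (¬? ∘ N?) xs)  ≤⟨ +-mono-≤
    (small N _ (Unique.filter⁺ N? u!) (all-filter N? xs))
    (pigeonhole-fibres N k f small _ (Unique.filter⁺ (¬? ∘ N?) u!) below) ⟩
  k + N * k                                             ∎
  where
  open ≤-Reasoning
  N? : Decidable (λ (x : X) → f x ≡ N)
  N? x = f x ≟ N
  below : All (λ x → f x < N) (filter (¬? ∘ N?) xs)
  below = All.zipWith (λ (p , q) → ≤∧≢⇒< (≤-pred p) q)
    (All.filter⁺ (¬? ∘ N?) f< , all-filter (¬? ∘ N?) xs)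

unique-length : ∀ {n} (xs : List (Fin n)) → Unique xs → length xs ≤ n
unique-length {n} xs u! = subst (length xs ≤_) (*-identityʳ n)
  (pigeonhole-fibres n 1 toℕ single xs u! (All.universal toℕ<n xs))
  where
  single : ∀ m (ys : List (Fin n)) → Unique ys → All (λ x → toℕ x ≡ m) ys → length ys ≤ 1
  single m []          _ _ = z≤n
  single m (_ ∷ [])    _ _ = s≤s z≤n
  single m (_ ∷ _ ∷ _) ((x≢y ∷ _) ∷ _) (p ∷ q ∷ _) = ⊥-elim (x≢y (toℕ-injective (trans p (sym q))))

map-unique : ∀ {P : Pred X 0ℓ} {f : X → Y} → (∀ {x y} → P x → P y → f x ≡ f y → x ≡ y) →
  ∀ {xs} → All P xs → Unique xs → Unique (map f xs)
map-unique inj [] [] = []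
map-unique {X = X} {P = P} {f} inj (px ∷ pxs) (x∉ ∷ u!) = fresh pxs x∉ ∷ map-unique inj pxs u!
  where
  fresh : ∀ {ys} → All P ys → All (_ ≢_) ys → All (f _ ≢_) (map f ys)
  fresh [] [] = []
  fresh (py ∷ pys) (x≢y ∷ x∉) = x≢y ∘ inj px py ∷ fresh pys x∉

maximum : ∀ {n} (f : Fin n → ℕ) → ∃[ m ] ∀ i → f i ≤ m
maximum {zero}  f = 0 , λ ()
maximum {suc n} f with maximum (f ∘ suc)
... | m , b = f zero ⊔ m , λ { zero → m≤m⊔n _ _ ; (suc i) → m≤n⇒m≤o⊔n (f zero) (b i) }

maximum-list : ∀ (f : X → ℕ) xs → ∃[ m ] ∀ {x} → x ∈ xs → f x ≤ m
maximum-list f [] = 0 , λ ()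
maximum-list f (x ∷ xs) with maximum-list f xs
... | m , b = f x ⊔ m , λ { (here refl) → m≤m⊔n _ _ ; (there i) → m≤n⇒m≤o⊔n (f x) (b i) }

code : ∀ {n} → Maybe (Fin n) → Fin (suc n)
code nothing  = zero
code (just i) = suc i

code-injective : ∀ {n} {x y : Maybe (Fin n)} → code x ≡ code y → x ≡ y
code-injective {x = nothing} {nothing} _  = refl
code-injective {x = just _}  {just _}  eq = cong just (Fin.suc-injective eq)

-- Short accepting completions in the transducer

module Transducer {s g} (T : NFT s g) where
  open NFT T

  Final : Fin nQ → List (Fin s) → List (Fin g) → Set
  Final q a u = Σ (Fin nQ) λ f → Path T q a u f × F f ≡ true

  path-++ : ∀ {p q r a b u v} → Path T p a u q → Path T q b v r → Path T p (a ++ b) (u ++ v) r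
  path-++ nil ρ = ρ
  path-++ {v = v} (cons {w = w} {u = u} e π) ρ =
    subst (λ z → Path T _ _ z _) (sym (++-assoc w u v)) (cons e (path-++ π ρ))

  states : ∀ {p a u q} → Path T p a u q → List (Fin nQ)
  states (nil {q})        = q ∷ []
  states (cons {q = q} _ π) = q ∷ states π

  length-states : ∀ {p a u q} (π : Path T p a u q) → length (states π) ≡ suc (length a)
  length-states nil        = refl
  length-states (cons _ π) = cong suc (length-states π)

  Simple : Fin nQ → Fin nQ → Set
  Simple p q = ∃₂ λ a u → Σ (Path T p a u q) λ π → Unique (states π)

  suffix-at : ∀ {p a u q r} (π : Path T p a u q) → Unique (states π) → r ∈ states π → Simple r q
  suffix-at nil u! (here refl) = _ , _ , nil , u!
  suffix-at (cons e π) u! (here refl) = _ , _ , cons e π , u!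
  suffix-at (cons e π) (_ ∷ u!) (there i) = suffix-at π u! i

  -- Loop removal: if `p` recurs on the simplified rest, the path restarts from that occurrence.
  -- This alters input and output, so only the end states are kept, which is all that acceptance
  -- depends on.
  simplify : ∀ {p a u q} → Path T p a u q → Simple p q
  simplify nil = _ , _ , nil , [] ∷ []
  simplify {p} (cons e π) with simplify π
  ... | _ , _ , ρ , u! with DecMembership._∈?_ Fin._≟_ p (states ρ)
  ...   | yes i = suffix-at ρ u! i
  ...   | no ∉  = _ , _ , cons e ρ , ¬Any⇒All¬ _ ∉ ∷ u!

  emission-bound : ∃[ L ] ∀ {q σ q′ w} → (q′ , w) ∈ δ q σ → length w ≤ L
  emission-bound = proj₁ total , λ {q} {σ} i →
      ≤-trans (proj₂ (at q σ) i) (≤-trans (proj₂ (row q) σ) (proj₂ total q))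
    where
    at : ∀ q σ → ∃[ m ] ∀ {x} → x ∈ δ q σ → length (proj₂ x) ≤ m
    at q σ = maximum-list (length ∘ proj₂) (δ q σ)
    row : ∀ q → ∃[ m ] ∀ σ → proj₁ (at q σ) ≤ m
    row q = maximum (proj₁ ∘ at q)
    total = maximum (proj₁ ∘ row)

  L : ℕ
  L = proj₁ emission-bound

  length-output : ∀ {p a u q} → Path T p a u q → length u ≤ length a * L
  length-output nil = z≤n
  length-output (cons {w = w} e π) = subst (_≤ _) (sym (length-++ w))
    (+-mono-≤ (proj₂ emission-bound e) (length-output π))

  -- A path without repeated states visits at most `nQ` of them, and each transition emits at most
  -- `L` letters.
  short-completion : ∀ {q b w} → Final q b w →
    ∃₂ λ b′ w′ → Final q b′ w′ × length b′ ≤ nQ × length w′ ≤ nQ * L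
  short-completion (f , π , acc) with simplify π
  ... | b′ , w′ , ρ , u! = b′ , w′ , (f , ρ , acc) , b′≤ , ≤-trans (length-output ρ) (*-monoˡ-≤ L b′≤)
    where
    b′≤ : length b′ ≤ nQ
    b′≤ = <⇒≤ (subst (_≤ nQ) (length-states ρ) (unique-length _ u!))

  W : ℕ
  W = L + nQ * L

  -- The path is followed up to a transition whose output covers what is left of `m`. That
  -- transition emits at most `L` letters `r` beyond the cut, and a short completion from its target
  -- adds at most `nQ * L` more; hence the two summands of `W`.
  complete-after : ∀ {q b} m w {f} → Path T q b (m ++ w) f → F f ≡ true →
    ∃₂ λ b′ w′ → Final q b′ (m ++ w′) × length w′ ≤ W
  complete-after {q} m w {f} π acc = go π m refl
    where
    go : ∀ {q b z} → Path T q b z f → ∀ m → z ≡ m ++ w → ∃₂ λ b′ w′ → Final q b′ (m ++ w′) × length w′ ≤ W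
    go nil [] eq = [] , [] , (f , nil , acc) , z≤n
    go (cons {w = w₁} {u = u} e π) m eq with ++-compare w₁ m eq
    ... | inj₁ (r , refl , _) with short-completion (f , π , acc)
    ...   | b′ , w′ , (f′ , ρ , acc′) , _ , w′≤ = _ ∷ b′ , r ++ w′ ,
              (f′ , subst (λ z → Path T _ _ z f′) (++-assoc m r w′) (cons e ρ) , acc′) ,
              subst (_≤ W) (sym (length-++ r))
                (+-mono-≤ (≤-trans (subst (length r ≤_) (sym (length-++ m)) (m≤n+m _ _)) (proj₂ emission-bound e)) w′≤)
    go (cons {w = w₁} e π) m eq | inj₂ (r , refl , eq′) with go π r eq′
    ...   | b′ , w′ , (f′ , ρ , acc′) , w′≤ = _ ∷ b′ , w′ ,
              (f′ , subst (λ z → Path T _ _ z f′) (sym (++-assoc w₁ r w′)) (cons e ρ) , acc′) , w′≤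

-- Cutting and comparing runs of the two-tape automaton

module TwoTape {s g} (A : 2DFA s g) where
  open 2DFA A

  Accepts : Fin nQ → List (Fin s) → List (Fin g) → Set
  Accepts q a u = Σ (Fin nQ) λ f → Run A q a u f × F f ≡ true

  -- The run on (α ++ a , y ++ u) from q passes through the remaining pair
  -- (a , u).  As a step looks at the symbols under the heads, that remainder
  -- may only be replaced by one with the same two first symbols.
  record Passes (q : Fin nQ) (α : List (Fin s)) (y : List (Fin g))
                (a : List (Fin s)) (u : List (Fin g)) : Set where
    constructor passes
    field
      state   : Fin nQ
      accepts : Accepts state a u
      link    : ∀ {a′ u′} → head? a′ ≡ head? a → head? u′ ≡ head? u →
                Accepts state a′ u′ → Accepts q (α ++ a′) (y ++ u′)

  open Passes

  start : ∀ {q a u} → Accepts q a u → Passes q [] [] a u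
  start c = passes _ c (λ _ _ c′ → c′)

  -- The symbols read stay the same when the remainder is replaced by one with the same first
  -- symbols, even if `α` or `y` is empty. So `δ` prescribes the same step for every admissible
  -- replacement.
  passes-step : ∀ {q q₁ α α₁ y y₁ a u x c m₁ m₂} → ¬ (x ≡ nothing × c ≡ nothing) →
    δ q x c ≡ (q₁ , m₁ , m₂) → head? (α ++ a) ≡ x → head? (y ++ u) ≡ c →
    (∀ a′ → move m₁ (α ++ a′) ≡ α₁ ++ a′) → (∀ u′ → move m₂ (y ++ u′) ≡ y₁ ++ u′) →
    Passes q₁ α₁ y₁ a u → Passes q α y a u
  passes-step {q} {q₁} {α} {y = y} nonblank eq hx hc mv₁ mv₂ (passes p c l) = passes p c λ {a′} {u′} ha hu c′ →
    let f , r , acc = l ha hu c′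
        hx′ = trans (head?-++ α ha) hx
        hc′ = trans (head?-++ y hu) hc
    in f , step (λ (a≡[] , u≡[]) → nonblank (trans (sym hx′) (cong head? a≡[]) , trans (sym hc′) (cong head? u≡[])))
             (trans (cong₂ (δ q) hx′ hc′) eq)
             (subst₂ (λ v w → Run A q₁ v w f) (sym (mv₁ a′)) (sym (mv₂ u′)) r) , acc

  passes-trans : ∀ {q α y β z a u} (π : Passes q α y (β ++ a) (z ++ u)) →
    Passes (state π) β z a u → Passes q (α ++ β) (y ++ z) a u
  passes-trans {q} {α} {y} {β} {z} (passes p _ l) (passes p′ c l′) = passes p′ c λ {a′} {u′} ha hu c′ →
    subst₂ (Accepts q) (sym (++-assoc α β a′)) (sym (++-assoc y z u′))
      (l (head?-++ β ha) (head?-++ z hu) (l′ ha hu c′))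

  -- A run ends only when both tapes are exhausted, so at some moment the input head has just passed
  -- `α`; `y` is the output read by then.
  consume-input : ∀ {q} α {a u f} → Run A q (α ++ a) u f → F f ≡ true →
    ∃₂ λ y u′ → u ≡ y ++ u′ × Passes q α y a u′
  consume-input [] {u = u} r acc = [] , u , refl , start (_ , r , acc)
  consume-input (x ∷ α) (step {m₁ = Stay} {Stay} ne eq r) acc with consume-input (x ∷ α) r acc
  ... | y , _ , refl , π = y , _ , refl , passes-step (λ ()) eq refl refl (λ _ → refl) (λ _ → refl) π
  consume-input (x ∷ α) (step {m₁ = Advance} {Stay} ne eq r) acc with consume-input α r acc
  ... | y , _ , refl , π = y , _ , refl , passes-step (λ ()) eq refl refl (λ _ → refl) (λ _ → refl) π
  consume-input (x ∷ α) (step {u = []} {m₂ = Advance} ne eq r) acc with () ← blank-stay₂ _ _ eq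
  consume-input (x ∷ α) (step {u = c ∷ _} {m₁ = Stay} {Advance} ne eq r) acc with consume-input (x ∷ α) r acc
  ... | y , _ , refl , π = c ∷ y , _ , refl , passes-step (λ ()) eq refl refl (λ _ → refl) (λ _ → refl) π
  consume-input (x ∷ α) (step {u = c ∷ _} {m₁ = Advance} {Advance} ne eq r) acc with consume-input α r acc
  ... | y , _ , refl , π = c ∷ y , _ , refl , passes-step (λ ()) eq refl refl (λ _ → refl) (λ _ → refl) π

  consume-output : ∀ {q} y {a u f} → Run A q a (y ++ u) f → F f ≡ true →
    ∃₂ λ α a′ → a ≡ α ++ a′ × Passes q α y a′ u
  consume-output [] {a} r acc = [] , a , refl , start (_ , r , acc)
  consume-output (x ∷ y) (step {m₁ = Stay} {Stay} ne eq r) acc with consume-output (x ∷ y) r acc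
  ... | α , _ , refl , π = α , _ , refl , passes-step (λ ()) eq refl refl (λ _ → refl) (λ _ → refl) π
  consume-output (x ∷ y) (step {m₁ = Stay} {Advance} ne eq r) acc with consume-output y r acc
  ... | α , _ , refl , π = α , _ , refl , passes-step (λ ()) eq refl refl (λ _ → refl) (λ _ → refl) π
  consume-output (x ∷ y) (step {a = []} {m₁ = Advance} ne eq r) acc with () ← blank-stay₁ _ _ eq
  consume-output (x ∷ y) (step {a = c ∷ _} {m₁ = Advance} {Stay} ne eq r) acc with consume-output (x ∷ y) r acc
  ... | α , _ , refl , π = c ∷ α , _ , refl , passes-step (λ ()) eq refl refl (λ _ → refl) (λ _ → refl) π
  consume-output (x ∷ y) (step {a = c ∷ _} {m₁ = Advance} {Advance} ne eq r) acc with consume-output y r acc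
  ... | α , _ , refl , π = c ∷ α , _ , refl , passes-step (λ ()) eq refl refl (λ _ → refl) (λ _ → refl) π

  -- For steps of `compare-runs` that leave the output head in place: `y₁` may be empty, and then
  -- the symbol under the head comes from `y₂`.
  head-split : ∀ {z : Fin g} {y u} y₁ {y₂} → z ∷ y ≡ y₁ ++ y₂ → head? (y₁ ++ (y₂ ++ u)) ≡ just z
  head-split y₁ {y₂} p = trans (cong head? (sym (++-assoc y₁ y₂ _))) (cong (λ v → head? (v ++ _)) (sym p))

  -- By determinism both runs agree until α or y is used up.
  compare-runs : ∀ {q} α y {a₁ u₁ f₁ a₂ u₂ f₂} →
    Run A q (α ++ a₁) (y ++ u₁) f₁ → F f₁ ≡ true →
    Run A q (α ++ a₂) (y ++ u₂) f₂ → F f₂ ≡ true →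
    (∃₂ λ e u′ → u₂ ≡ e ++ u′ × Passes q α (y ++ e) a₂ u′) ⊎
    (∃₂ λ y₁ y₂ → y ≡ y₁ ++ y₂ × Passes q α y₁ a₁ (y₂ ++ u₁))
  compare-runs [] y r acc r′ acc′ = inj₂ ([] , y , refl , start (_ , r , acc))
  -- Here `y` is used up first: the second run goes on alone to the end of `α`, and `e` is the
  -- further output it reads on the way.
  compare-runs (x ∷ α) [] r acc r′ acc′ = inj₁ (consume-input (x ∷ α) r′ acc′)
  compare-runs (x ∷ α) (z ∷ y) (step {m₁ = Stay} {Stay} _ eq r) acc (step _ eq′ r′) acc′
    with refl ← trans (sym eq) eq′ with compare-runs (x ∷ α) (z ∷ y) r acc r′ acc′
  ... | inj₁ (e , u′ , p , π) = inj₁ (e , u′ , p , passes-step (λ ()) eq refl refl (λ _ → refl) (λ _ → refl) π)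
  ... | inj₂ (y₁ , y₂ , p , π) = inj₂ (y₁ , y₂ , p , passes-step (λ ()) eq refl (head-split y₁ p) (λ _ → refl) (λ _ → refl) π)
  compare-runs (x ∷ α) (z ∷ y) (step {m₁ = Advance} {Stay} _ eq r) acc (step _ eq′ r′) acc′
    with refl ← trans (sym eq) eq′ with compare-runs α (z ∷ y) r acc r′ acc′
  ... | inj₁ (e , u′ , p , π) = inj₁ (e , u′ , p , passes-step (λ ()) eq refl refl (λ _ → refl) (λ _ → refl) π)
  ... | inj₂ (y₁ , y₂ , p , π) = inj₂ (y₁ , y₂ , p , passes-step (λ ()) eq refl (head-split y₁ p) (λ _ → refl) (λ _ → refl) π)
  compare-runs (x ∷ α) (z ∷ y) (step {m₁ = Stay} {Advance} _ eq r) acc (step _ eq′ r′) acc′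
    with refl ← trans (sym eq) eq′ with compare-runs (x ∷ α) y r acc r′ acc′
  ... | inj₁ (e , u′ , p , π) = inj₁ (e , u′ , p , passes-step (λ ()) eq refl refl (λ _ → refl) (λ _ → refl) π)
  ... | inj₂ (y₁ , y₂ , refl , π) = inj₂ (z ∷ y₁ , y₂ , refl , passes-step (λ ()) eq refl refl (λ _ → refl) (λ _ → refl) π)
  compare-runs (x ∷ α) (z ∷ y) (step {m₁ = Advance} {Advance} _ eq r) acc (step _ eq′ r′) acc′
    with refl ← trans (sym eq) eq′ with compare-runs α y r acc r′ acc′
  ... | inj₁ (e , u′ , p , π) = inj₁ (e , u′ , p , passes-step (λ ()) eq refl refl (λ _ → refl) (λ _ → refl) π)
  ... | inj₂ (y₁ , y₂ , refl , π) = inj₂ (z ∷ y₁ , y₂ , refl , passes-step (λ ()) eq refl refl (λ _ → refl) (λ _ → refl) π)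

  -- Moves the point of the run forward by `n` output letters, so that one run yields many points to
  -- count.
  split-output : ∀ {q α y a u} → Passes q α y a u → ∀ n →
    ∃₂ λ β a′ → a ≡ β ++ a′ × Passes q (α ++ β) (y ++ take n u) a′ (drop n u)
  split-output {u = u} π n with take n u | drop n u | take++drop≡id n u
  ... | z | u′ | refl with accepts π
  ...   | f , r , acc with consume-output z r acc
  ...     | β , a′ , refl , ρ = β , a′ , refl , passes-trans π ρ

-- Counting points of runs under finite-valuedness

module FiniteValuedTwoTape {s g} (A : 2DFA s g) (k : ℕ)
  (few : ∀ a us → Unique us → All (L2DFA A a) us → length us ≤ k) where
  open 2DFA A
  open TwoTape A
  open Passes

  -- `k` points for each key: a state, a possibly blank symbol under each head, and one of `B`
  -- classes.
  N : ℕ → ℕ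
  N B = nQ * (suc s * (suc g * B)) * k

  -- Points with the same state, the same symbols under the heads and the same
  -- consumed input may exchange their futures, so that their distinct consumed
  -- outputs become distinct outputs for one input.
  passes-bound : ∀ {M B} (c : Fin M → Fin B) {α a : Fin M → List (Fin s)} {y u : Fin M → List (Fin g)}
    (π : ∀ x → Passes q₀ (α x) (y x) (a x) (u x)) →
    (∀ {x x′} → c x ≡ c x′ → α x ≡ α x′) →
    (∀ {x x′} → c x ≡ c x′ → length (y x) ≡ length (y x′) → x ≡ x′) →
    M ≤ N B
  passes-bound {M} {B} c {α} {a} {y} {u} π same-input separated =
    subst (_≤ N B) (length-tabulate id)
      (pigeonhole-fibres _ k (toℕ ∘ key) fibre (allFin M) (Unique.allFin⁺ M) (All.universal (toℕ<n ∘ key) _))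
    where
    key : Fin M → Fin (nQ * (suc s * (suc g * B)))
    key x = combine (state (π x)) (combine (code (head? (a x))) (combine (code (head? (u x))) (c x)))

    key-injective : ∀ {x x′} → key x ≡ key x′ →
      state (π x) ≡ state (π x′) × head? (a x) ≡ head? (a x′) × head? (u x) ≡ head? (u x′) × c x ≡ c x′
    key-injective {x} {x′} eq with combine-injective (state (π x)) _ (state (π x′)) _ eq
    ... | p , eq₁ with combine-injective (code (head? (a x))) _ (code (head? (a x′))) _ eq₁
    ...   | q , eq₂ with combine-injective (code (head? (u x))) _ (code (head? (u x′))) _ eq₂
    ...     | r , t = p , code-injective q , code-injective r , t

    fibre : ∀ n xs → Unique xs → All (λ x → toℕ (key x) ≡ n) xs → length xs ≤ k
    fibre n [] _ _ = z≤n
    fibre n xs@(x₀ ∷ _) u! keys@(key₀ ∷ _) = subst (_≤ k) (length-map _ xs)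
      -- All points of the fibre receive the future of `x₀`. Their outputs then share the suffix
      -- `u x₀`, which cancels, so that distinct points give distinct outputs.
      (few (α x₀ ++ a x₀) (map (λ x → y x ++ u x₀) xs) (map-unique distinct keys u!) (outputs keys))
      where
      same-key : ∀ {x x′} → toℕ (key x) ≡ n → toℕ (key x′) ≡ n → key x ≡ key x′
      same-key p q = toℕ-injective (trans p (sym q))

      distinct : ∀ {x x′} → toℕ (key x) ≡ n → toℕ (key x′) ≡ n → y x ++ u x₀ ≡ y x′ ++ u x₀ → x ≡ x′
      distinct {x} {x′} p q eq = separated (proj₂ (proj₂ (proj₂ (key-injective (same-key p q)))))
        (cong length (++-cancelʳ (u x₀) (y x) (y x′) eq))

      outputs : ∀ {zs} → All (λ x → toℕ (key x) ≡ n) zs →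
        All (L2DFA A (α x₀ ++ a x₀)) (map (λ x → y x ++ u x₀) zs)
      outputs [] = []
      outputs {x ∷ _} (p ∷ ps) with key-injective (same-key key₀ p)
      ... | eq , ha , hu , ec = subst (λ β → L2DFA A (β ++ a x₀) _) (sym (same-input ec))
              (link (π x) ha hu (subst (λ q → Accepts q _ _) eq (accepts (π x₀)))) ∷ outputs ps

  -- The run is cut after each of the `suc (length z)` prefixes of `z`, the empty one included. The
  -- class of a cut is the number of letters of `b` read so far, one of `suc n` values; it
  -- determines which prefix of `b` was read.
  output-bound : ∀ {a y b z n} → Passes q₀ a y b z → length b ≤ n → length z < N (suc n)
  output-bound {a} {y} {b} {z} {n} π b≤n =
    passes-bound c (proj₂ ∘ proj₂ ∘ proj₂ ∘ split) (λ {x} {x′} eq → cong (a ++_) (same {x} {x′} eq)) (λ _ → separated)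
    where
    split : (x : Fin (suc (length z))) → _
    split x = split-output π (toℕ x)

    consumed : Fin (suc (length z)) → List (Fin s)
    consumed x = proj₁ (split x)

    consumed≤ : ∀ x → length (consumed x) ≤ n
    consumed≤ x = ≤-trans (subst (length (consumed x) ≤_)
      (trans (sym (length-++ (consumed x))) (cong length (sym (proj₁ (proj₂ (proj₂ (split x))))))) (m≤m+n _ _)) b≤n

    c : Fin (suc (length z)) → Fin (suc n)
    c x = fromℕ< (s≤s (consumed≤ x))

    same : ∀ {x x′} → c x ≡ c x′ → consumed x ≡ consumed x′
    same {x} {x′} eq = prefix-unique (consumed x) (consumed x′)
      (trans (sym (proj₁ (proj₂ (proj₂ (split x))))) (proj₁ (proj₂ (proj₂ (split x′)))))
      (Fin.fromℕ<-injective _ _ _ _ eq)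

    separated : ∀ {x x′} → length (y ++ take (toℕ x) z) ≡ length (y ++ take (toℕ x′) z) → x ≡ x′
    separated {x} {x′} eq = toℕ-injective (begin
      toℕ x                      ≡⟨ sym (length-take-≤ (≤-pred (toℕ<n x))) ⟩
      length (take (toℕ x) z)    ≡⟨ length-++-cancelˡ y eq ⟩
      length (take (toℕ x′) z)   ≡⟨ length-take-≤ (≤-pred (toℕ<n x′)) ⟩
      toℕ x′                     ∎)
      where open ≡-Reasoning

-- Bounded trailing

theorem2 : {s g : ℕ} (T : NFT s g) → FiniteValued T →
    ∃[ A ] Equivalent T A → BoundedTrailing T
theorem2 {s} {g} T (k , few) (A , equiv) = C + D , bound
  where
  open Transducer T
  open TwoTape A
  open FiniteValuedTwoTape A k
    (λ a us u! all → few a us u! (All.map (λ {u} → Equivalence.from (equiv a u)) all))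

  -- `C` exceeds the output that can remain when at most `nQ` input letters do. `D` limits the
  -- number of cuts whose excess output has length at most `W`.
  C D : ℕ
  C = N (suc (NFT.nQ T))
  D = N (suc W)

  bound : ∀ q₁ q₂ f₁ f₂ a b₁ b₂ u v w₁ w₂ →
    Path T (NFT.q₀ T) a (u ++ v) q₁ → Path T q₁ b₁ w₁ f₁ → NFT.F T f₁ ≡ true →
    Path T (NFT.q₀ T) a u q₂ → Path T q₂ b₂ (v ++ w₂) f₂ → NFT.F T f₂ ≡ true →
    length v ≤ C + D
  bound q₁ q₂ f₁ f₂ a b₁ b₂ u v w₁ w₂ π₁ ρ₁ acc₁ π₂ ρ₂ acc₂ with length v ≤? C + D
  ... | yes v≤ = v≤
  -- The cuts after 0 to `D` letters of `v` are `suc D` points, but `passes-bound` allows only `D`.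
  -- All of them have consumed the same input `a`.
  ... | no  v≰ = ⊥-elim (<-irrefl refl (passes-bound c (proj₂ ∘ proj₂ ∘ ahead) (λ _ → refl) separated))
    where
    x≤v : (x : Fin (suc D)) → toℕ x ≤ length v
    x≤v x = ≤-trans (≤-pred (toℕ<n x)) (≤-trans (m≤n+m D C) (<⇒≤ (≰⇒> v≰)))

    C≤drop : (x : Fin (suc D)) → C ≤ length (drop (toℕ x) v)
    C≤drop x = subst (C ≤_) (sym (length-drop (toℕ x) v))
      (m+n≤o⇒m≤o∸n C (≤-trans (+-monoʳ-≤ C (≤-pred (toℕ<n x))) (<⇒≤ (≰⇒> v≰))))

    -- Path 1 forces A to be ahead of path 2: A has output u and the first x
    -- letters of v behind it when it comes to the end of a.
    ahead : (x : Fin (suc D)) → ∃ λ ((b , u′ , e) : List (Fin s) × List (Fin g) × List (Fin g)) →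
      length e ≤ W × Passes (2DFA.q₀ A) a ((u ++ take (toℕ x) v) ++ e) b u′
    ahead x
      with short-completion (_ , ρ₁ , acc₁)
         | complete-after (take (toℕ x) v) (drop (toℕ x) v ++ w₂)
             (subst (λ z → Path T _ _ z _) (trans (cong (_++ w₂) (sym (take++drop≡id (toℕ x) v))) (++-assoc (take (toℕ x) v) _ _)) ρ₂) acc₂
    ... | b , w , (f , ρ , acc) , b≤ , _ | b′ , w′ , (f′ , ρ′ , acc′) , w′≤
      with Equivalence.to (equiv _ _) (f , path-++ π₁ ρ , acc)
         | Equivalence.to (equiv _ _) (f′ , path-++ π₂ ρ′ , acc′)
    ... | h , r , hacc | h′ , r′ , hacc′
      with compare-runs a (u ++ take (toℕ x) v) (subst (λ z → Run A _ _ z _) regroup r) hacc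
             (subst (λ z → Run A _ _ z _) (sym (++-assoc u _ w′)) r′) hacc′
      where
      regroup : (u ++ v) ++ w ≡ (u ++ take (toℕ x) v) ++ (drop (toℕ x) v ++ w)
      regroup = begin
        (u ++ v) ++ w                                        ≡⟨ cong (λ z → (u ++ z) ++ w) (sym (take++drop≡id (toℕ x) v)) ⟩
        (u ++ (take (toℕ x) v ++ drop (toℕ x) v)) ++ w       ≡⟨ cong (_++ w) (sym (++-assoc u _ _)) ⟩
        ((u ++ take (toℕ x) v) ++ drop (toℕ x) v) ++ w       ≡⟨ ++-assoc (u ++ take (toℕ x) v) _ w ⟩
        (u ++ take (toℕ x) v) ++ (drop (toℕ x) v ++ w)       ∎
        where open ≡-Reasoning
    ... | inj₁ (e , u′ , refl , σ) = (b′ , u′ , e) ,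
            ≤-trans (subst (length e ≤_) (sym (length-++ e)) (m≤m+n _ _)) w′≤ , σ
    -- Otherwise the run for path 1 would come to the end of `a` with at least `C` output letters
    -- left, although its remaining input `b` is short.
    ... | inj₂ (_ , y₂ , _ , σ) = ⊥-elim (<⇒≱ (output-bound σ b≤) (begin
      C                                                       ≤⟨ C≤drop x ⟩
      length (drop (toℕ x) v)                                 ≤⟨ m≤m+n _ _ ⟩
      length (drop (toℕ x) v) + length w                      ≡⟨ sym (length-++ (drop (toℕ x) v)) ⟩
      length (drop (toℕ x) v ++ w)                            ≤⟨ m≤n+m _ (length y₂) ⟩
      length y₂ + length (drop (toℕ x) v ++ w)                ≡⟨ sym (length-++ y₂) ⟩
      length (y₂ ++ (drop (toℕ x) v ++ w))                    ∎))
      where open ≤-Reasoning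

    excess : Fin (suc D) → List (Fin g)
    excess x = proj₂ (proj₂ (proj₁ (ahead x)))

    -- Cuts are classed by the length of their excess: with different excesses, two cuts could have
    -- consumed equally long outputs.
    c : Fin (suc D) → Fin (suc W)
    c x = fromℕ< (s≤s (proj₁ (proj₂ (ahead x))))

    separated : ∀ {x x′} → c x ≡ c x′ →
      length ((u ++ take (toℕ x) v) ++ excess x) ≡ length ((u ++ take (toℕ x′) v) ++ excess x′) → x ≡ x′
    separated {x} {x′} ceq eq = toℕ-injective (begin
      toℕ x                      ≡⟨ sym (length-take-≤ (x≤v x)) ⟩
      length (take (toℕ x) v)    ≡⟨ length-++-cancelˡ u (+-cancelʳ-≡ (length (excess x′)) _ _ (begin
        length (u ++ take (toℕ x) v) + length (excess x′)  ≡⟨ cong (length (u ++ take (toℕ x) v) +_) (sym (Fin.fromℕ<-injective _ _ _ _ ceq)) ⟩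
        length (u ++ take (toℕ x) v) + length (excess x)   ≡⟨ sym (length-++ (u ++ take (toℕ x) v)) ⟩
        length ((u ++ take (toℕ x) v) ++ excess x)         ≡⟨ eq ⟩
        length ((u ++ take (toℕ x′) v) ++ excess x′)       ≡⟨ length-++ (u ++ take (toℕ x′) v) ⟩
        length (u ++ take (toℕ x′) v) + length (excess x′) ∎)) ⟩
      length (take (toℕ x′) v)   ≡⟨ length-take-≤ (x≤v x′) ⟩
      toℕ x′                     ∎)
      where open ≡-Reasoning
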